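{- Let $G$ be a simple distance-regular graph with adjacency matrix $M$, let $r\le\operatorname{diam}(G)$ be a nonnegative integer, and let $p_r^B(x),p_r^W(x)\in\mathbb R[x]$ be polynomials expressing balls and spheres of radius $r$ in $G$, respectively, i.e. for each $u\in V(G)$ the rows $[p_r^B(M)]^u$ and $[p_r^W(M)]^u$ are the indicator functions of the ball $B_r(u)$ and of the sphere $W_r(u)$, respectively. Suppose that $f$ is a perfect coloring of $G$ with parameter matrix $S$. Then for all vertices $u,v\in V(G)$, $$|B_r(u)\,\Delta\,B_r(v)|\ \ge\ d([p_r^B(S)]^{f(u)},[p_r^B(S)]^{f(v)}),$$ $$|W_r(u)\,\Delta\,W_r(v)|\ \ge\ d([p_r^W(S)]^{f(u)},[p_r^W(S)]^{f(v)}).$$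
   Context: For vertices $u,v$ of $G$, $\rho(u,v)$ is the graph distance (length of a shortest path). The ball and sphere of radius $r$ with center $u$ are $B_r(u)=\{v:\rho(u,v)\le r\}$ and $W_r(u)=\{v:\rho(u,v)=r\}$. $\Delta$ denotes symmetric difference. A perfect coloring of $G$ with parameter matrix $S=(s_{i,j})$ of order $k$ is a map $f:V(G)\to\{1,\dots,k\}$ such that every vertex $u$ with $f(u)=i$ has exactly $s_{i,j}$ neighbors of color $j$, for all colors $i,j$. $[A]^i$ denotes the $i$-th row of a square matrix $A$. For real tuples $x,y$ of the same length, $d(x,y)=\sum_i|x_i-y_i|$ is the $L_1$ distance. (In a distance-regular graph, polynomials $p_r^B,p_r^W$ as in the claim exist for every $r\le\operatorname{diam}(G)$.) -}

module Defs where

open import Algebra.Bundles.Raw using (RawRing)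
import Algebra.Definitions.RawMonoid as RawMonoidDefs
open import Data.Bool using (if_then_else_)
open import Data.Fin using (Fin)
import Data.Fin as Fin
import Data.Fin.Properties as Fin
open import Data.Fin.Subset using (Subset; _∩_; _∪_; _─_; ∣_∣)
import Data.Integer as ℤ
open import Data.List using (List; []; _∷_; allFin; cartesianProductWith)
open import Data.List.Extrema.Nat using (max)
open import Data.Nat using (ℕ; zero; suc; _⊔_; z≤n; s≤s; _≤?_; _≟_)
import Data.Nat as ℕ
import Data.Nat.Properties as ℕ
open import Data.Product using (∃; _×_; _,_; proj₁; proj₂)
open import Data.Rational using (ℚ; 0ℚ; 1ℚ; ½; Positive)
import Data.Rational as ℚ
import Data.Rational.Properties as ℚ
open import Data.Rational.Solver using (module +-*-Solver)
open import Data.Sum using (inj₁; inj₂)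
open import Data.Vec using (Vec; []; _∷_; head; last; lookup; tabulate)
open import Data.Vec.Functional using (Vector)
open import Data.Vec.Relation.Unary.AllPairs using (allPairs?)
open import Data.Vec.Relation.Unary.Linked using (Linked; linked?)
open import Data.Vec.Relation.Unary.Unique.Propositional using (Unique)
open import Function using (_∘_)
open import Level using (0ℓ)
open import Relation.Binary using (Rel; Symmetric; Irreflexive)
import Relation.Binary as B
open import Relation.Binary.PropositionalEquality using (_≡_; refl; sym; trans; cong; cong₂; subst)
open import Relation.Nullary using (Dec; yes; no; does; ¬?; contradiction; _×-dec_; map′)
open import Relation.Unary using (Pred; Decidable)

-- Real numbers are Cauchy sequences of rationals; their equality is _≈ℝ_, not _≡_.

infix 8 _within_
_within_ : (ℕ → ℕ → ℚ) → ℚ → Set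
t within ε = ∃ λ N → ∀ {m n} → N ℕ.≤ m → N ℕ.≤ n → t m n ℚ.≤ ε

Cauchy : (ℕ → ℚ) → Set
Cauchy x = ∀ ε → 0ℚ ℚ.< ε → (λ m n → ℚ.∣ x m ℚ.- x n ∣) within ε

record ℝ : Set where
  constructor mkℝ
  field
    seq    : ℕ → ℚ
    cauchy : Cauchy seq

open ℝ public

infix 4 _≈ℝ_ _≤ℝ_

_≈ℝ_ : Rel ℝ 0ℓ
x ≈ℝ y = ∀ ε → 0ℚ ℚ.< ε → ∃ λ N → ∀ {n} → N ℕ.≤ n → ℚ.∣ seq x n ℚ.- seq y n ∣ ℚ.≤ ε

_≤ℝ_ : Rel ℝ 0ℓ
x ≤ℝ y = ∀ ε → 0ℚ ℚ.< ε → ∃ λ N → ∀ {n} → N ℕ.≤ n → seq x n ℚ.≤ seq y n ℚ.+ ε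

module CauchyLemmas where
  private module _ where
    open +-*-Solver

    +-rearrange : ∀ a b c d → (a ℚ.+ b) ℚ.- (c ℚ.+ d) ≡ (a ℚ.- c) ℚ.+ (b ℚ.- d)
    +-rearrange = solve 4 (λ a b c d → (a :+ b) :- (c :+ d) := (a :- c) :+ (b :- d)) refl

    *-rearrange : ∀ a b c d → a ℚ.* b ℚ.- c ℚ.* d ≡ a ℚ.* (b ℚ.- d) ℚ.+ d ℚ.* (a ℚ.- c)
    *-rearrange = solve 4 (λ a b c d → a :* b :- c :* d := a :* (b :- d) :+ d :* (a :- c)) refl

    neg-rearrange : ∀ a b → (ℚ.- a) ℚ.- (ℚ.- b) ≡ ℚ.- (a ℚ.- b)
    neg-rearrange = solve 2 (λ a b → (:- a) :- (:- b) := :- (a :- b)) refl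

    sub-swap : ∀ a b → b ℚ.- a ≡ ℚ.- (a ℚ.- b)
    sub-swap = solve 2 (λ a b → b :- a := :- (a :- b)) refl

    sub-add : ∀ a b → (a ℚ.- b) ℚ.+ b ≡ a
    sub-add = solve 2 (λ a b → (a :- b) :+ b := a) refl

    add-sub : ∀ a b → (a ℚ.+ b) ℚ.- b ≡ a
    add-sub = solve 2 (λ a b → (a :+ b) :- b := a) refl

    halves : ∀ ε → ½ ℚ.* ε ℚ.+ ½ ℚ.* ε ≡ ε
    halves ε = trans (sym (ℚ.*-distribʳ-+ ε ½ ½)) (ℚ.*-identityˡ ε)

    distrib-cancel : ∀ a b ε i → a ℚ.* (ε ℚ.* i) ℚ.+ b ℚ.* (ε ℚ.* i) ≡ ε ℚ.* ((a ℚ.+ b) ℚ.* i)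
    distrib-cancel = solve 4 (λ a b ε i → a :* (ε :* i) :+ b :* (ε :* i) := ε :* ((a :+ b) :* i)) refl

  open ℚ.≤-Reasoning

  half-pos : ∀ {ε} → 0ℚ ℚ.< ε → 0ℚ ℚ.< ½ ℚ.* ε
  half-pos {ε} ε>0 = ℚ.positive⁻¹ _ {{ℚ.pos*pos⇒pos ½ ε {{ℚ.positive ε>0}}}}

  ∣a∣-∣b∣≤∣a-b∣ : ∀ a b → ℚ.∣ a ∣ ℚ.- ℚ.∣ b ∣ ℚ.≤ ℚ.∣ a ℚ.- b ∣
  ∣a∣-∣b∣≤∣a-b∣ a b = begin
    ℚ.∣ a ∣ ℚ.- ℚ.∣ b ∣                        ≡⟨ cong (λ z → ℚ.∣ z ∣ ℚ.- ℚ.∣ b ∣) (sub-add a b) ⟨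
    ℚ.∣ (a ℚ.- b) ℚ.+ b ∣ ℚ.- ℚ.∣ b ∣          ≤⟨ ℚ.+-monoˡ-≤ _ (ℚ.∣p+q∣≤∣p∣+∣q∣ (a ℚ.- b) b) ⟩
    (ℚ.∣ a ℚ.- b ∣ ℚ.+ ℚ.∣ b ∣) ℚ.- ℚ.∣ b ∣    ≡⟨ add-sub ℚ.∣ a ℚ.- b ∣ ℚ.∣ b ∣ ⟩
    ℚ.∣ a ℚ.- b ∣                              ∎

  ∣-∣-swap : ∀ a b → ℚ.∣ b ℚ.- a ∣ ≡ ℚ.∣ a ℚ.- b ∣
  ∣-∣-swap a b = trans (cong ℚ.∣_∣ (sub-swap a b)) (ℚ.∣-p∣≡∣p∣ (a ℚ.- b))

  ∣∣a∣-∣b∣∣≤∣a-b∣ : ∀ a b → ℚ.∣ ℚ.∣ a ∣ ℚ.- ℚ.∣ b ∣ ∣ ℚ.≤ ℚ.∣ a ℚ.- b ∣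
  ∣∣a∣-∣b∣∣≤∣a-b∣ a b with ℚ.∣p∣≡p∨∣p∣≡-p (ℚ.∣ a ∣ ℚ.- ℚ.∣ b ∣)
  ... | inj₁ eq = subst (ℚ._≤ ℚ.∣ a ℚ.- b ∣) (sym eq) (∣a∣-∣b∣≤∣a-b∣ a b)
  ... | inj₂ eq = begin
    ℚ.∣ ℚ.∣ a ∣ ℚ.- ℚ.∣ b ∣ ∣    ≡⟨ eq ⟩
    ℚ.- (ℚ.∣ a ∣ ℚ.- ℚ.∣ b ∣)    ≡⟨ sub-swap ℚ.∣ a ∣ ℚ.∣ b ∣ ⟨
    ℚ.∣ b ∣ ℚ.- ℚ.∣ a ∣          ≤⟨ ∣a∣-∣b∣≤∣a-b∣ b a ⟩
    ℚ.∣ b ℚ.- a ∣                ≡⟨ ∣-∣-swap a b ⟩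
    ℚ.∣ a ℚ.- b ∣                ∎

  *-mono-≤ : ∀ {a b c d} → 0ℚ ℚ.≤ c → 0ℚ ℚ.≤ b → a ℚ.≤ b → c ℚ.≤ d → a ℚ.* c ℚ.≤ b ℚ.* d
  *-mono-≤ {a} {b} {c} {d} c≥0 b≥0 a≤b c≤d = ℚ.≤-trans
    (ℚ.*-monoʳ-≤-nonNeg c {{ℚ.nonNegative c≥0}} a≤b)
    (ℚ.*-monoˡ-≤-nonNeg b {{ℚ.nonNegative b≥0}} c≤d)

  Bounded : (ℕ → ℚ) → Set
  Bounded x = ∃ λ b → Positive b × ∃ λ N → ∀ {n} → N ℕ.≤ n → ℚ.∣ x n ∣ ℚ.≤ b

  bounded : ∀ {x} → Cauchy x → Bounded x
  bounded {x} cx with cx 1ℚ (ℚ.positive⁻¹ 1ℚ)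
  ... | N , close = 1ℚ ℚ.+ ℚ.∣ x N ∣
                  , ℚ.pos+nonNeg⇒pos 1ℚ ℚ.∣ x N ∣ {{ℚ.∣-∣-nonNeg (x N)}}
                  , N , λ {n} N≤n → begin
      ℚ.∣ x n ∣                              ≡⟨ cong ℚ.∣_∣ (sub-add (x n) (x N)) ⟨
      ℚ.∣ (x n ℚ.- x N) ℚ.+ x N ∣            ≤⟨ ℚ.∣p+q∣≤∣p∣+∣q∣ (x n ℚ.- x N) (x N) ⟩
      ℚ.∣ x n ℚ.- x N ∣ ℚ.+ ℚ.∣ x N ∣        ≤⟨ ℚ.+-monoˡ-≤ _ (close N≤n ℕ.≤-refl) ⟩
      1ℚ ℚ.+ ℚ.∣ x N ∣                       ∎

  inverse : ∀ q → Positive q → ∃ λ i → Positive i × q ℚ.* i ≡ 1ℚ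
  inverse q q>0 = (ℚ.1/ q) {{q≢0}} , ℚ.1/pos⇒pos q {{q>0}} , ℚ.*-inverseʳ q {{q≢0}}
    where q≢0 = ℚ.pos⇒nonZero q {{q>0}}

  pos⇒≥0 : ∀ {q} → Positive q → 0ℚ ℚ.≤ q
  pos⇒≥0 {q} q>0 = ℚ.<⇒≤ (ℚ.positive⁻¹ q {{q>0}})

  *-bound : ∀ {a b x x′ y y′ δ} → Positive a → Positive b →
    ℚ.∣ x ∣ ℚ.≤ a → ℚ.∣ y′ ∣ ℚ.≤ b → ℚ.∣ x ℚ.- x′ ∣ ℚ.≤ δ → ℚ.∣ y ℚ.- y′ ∣ ℚ.≤ δ →
    ℚ.∣ x ℚ.* y ℚ.- x′ ℚ.* y′ ∣ ℚ.≤ a ℚ.* δ ℚ.+ b ℚ.* δ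
  *-bound {a} {b} {x} {x′} {y} {y′} {δ} a>0 b>0 x≤a y′≤b x-x′≤δ y-y′≤δ = begin
    ℚ.∣ x ℚ.* y ℚ.- x′ ℚ.* y′ ∣
      ≡⟨ cong ℚ.∣_∣ (*-rearrange x y x′ y′) ⟩
    ℚ.∣ x ℚ.* (y ℚ.- y′) ℚ.+ y′ ℚ.* (x ℚ.- x′) ∣
      ≤⟨ ℚ.∣p+q∣≤∣p∣+∣q∣ (x ℚ.* (y ℚ.- y′)) (y′ ℚ.* (x ℚ.- x′)) ⟩
    ℚ.∣ x ℚ.* (y ℚ.- y′) ∣ ℚ.+ ℚ.∣ y′ ℚ.* (x ℚ.- x′) ∣
      ≡⟨ cong₂ ℚ._+_ (ℚ.∣p*q∣≡∣p∣*∣q∣ x (y ℚ.- y′)) (ℚ.∣p*q∣≡∣p∣*∣q∣ y′ (x ℚ.- x′)) ⟩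
    ℚ.∣ x ∣ ℚ.* ℚ.∣ y ℚ.- y′ ∣ ℚ.+ ℚ.∣ y′ ∣ ℚ.* ℚ.∣ x ℚ.- x′ ∣
      ≤⟨ ℚ.+-mono-≤
           (*-mono-≤ (ℚ.0≤∣p∣ (y ℚ.- y′)) (pos⇒≥0 a>0) x≤a y-y′≤δ)
           (*-mono-≤ (ℚ.0≤∣p∣ (x ℚ.- x′)) (pos⇒≥0 b>0) y′≤b x-x′≤δ) ⟩
    a ℚ.* δ ℚ.+ b ℚ.* δ ∎

  split-ε : ∀ {a b ε} → Positive a → Positive b → 0ℚ ℚ.< ε →
    ∃ λ δ → 0ℚ ℚ.< δ × a ℚ.* δ ℚ.+ b ℚ.* δ ≡ ε
  split-ε {a} {b} {ε} a>0 b>0 ε>0 with inverse (a ℚ.+ b) (ℚ.pos+pos⇒pos a {{a>0}} b {{b>0}})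
  ... | i , i>0 , inv = ε ℚ.* i
    , ℚ.positive⁻¹ (ε ℚ.* i) {{ℚ.pos*pos⇒pos ε {{ℚ.positive ε>0}} i {{i>0}}}}
    , trans (distrib-cancel a b ε i) (trans (cong (ε ℚ.*_) inv) (ℚ.*-identityʳ ε))

  abstract
    constant-cauchy : ∀ q → Cauchy (λ _ → q)
    constant-cauchy q ε ε>0 = 0 , λ _ _ →
      subst (ℚ._≤ ε) (sym (cong ℚ.∣_∣ (ℚ.+-inverseʳ q))) (ℚ.<⇒≤ ε>0)

    +-cauchy : ∀ {x y} → Cauchy x → Cauchy y → Cauchy (λ n → x n ℚ.+ y n)
    +-cauchy {x} {y} cx cy ε ε>0 with cx (½ ℚ.* ε) (half-pos ε>0) | cy (½ ℚ.* ε) (half-pos ε>0)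
    ... | N₁ , close₁ | N₂ , close₂ = N₁ ⊔ N₂ , λ {m} {n} N≤m N≤n → begin
      ℚ.∣ (x m ℚ.+ y m) ℚ.- (x n ℚ.+ y n) ∣        ≡⟨ cong ℚ.∣_∣ (+-rearrange (x m) (y m) (x n) (y n)) ⟩
      ℚ.∣ (x m ℚ.- x n) ℚ.+ (y m ℚ.- y n) ∣        ≤⟨ ℚ.∣p+q∣≤∣p∣+∣q∣ (x m ℚ.- x n) (y m ℚ.- y n) ⟩
      ℚ.∣ x m ℚ.- x n ∣ ℚ.+ ℚ.∣ y m ℚ.- y n ∣      ≤⟨ ℚ.+-mono-≤
        (close₁ (ℕ.m⊔n≤o⇒m≤o N₁ N₂ N≤m) (ℕ.m⊔n≤o⇒m≤o N₁ N₂ N≤n))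
        (close₂ (ℕ.m⊔n≤o⇒n≤o N₁ N₂ N≤m) (ℕ.m⊔n≤o⇒n≤o N₁ N₂ N≤n)) ⟩
      ½ ℚ.* ε ℚ.+ ½ ℚ.* ε                          ≡⟨ halves ε ⟩
      ε                                            ∎

    neg-cauchy : ∀ {x} → Cauchy x → Cauchy (λ n → ℚ.- x n)
    neg-cauchy {x} cx ε ε>0 with cx ε ε>0
    ... | N , close = N , λ {m} {n} N≤m N≤n → subst (ℚ._≤ ε)
      (sym (trans (cong ℚ.∣_∣ (neg-rearrange (x m) (x n))) (ℚ.∣-p∣≡∣p∣ (x m ℚ.- x n))))
      (close N≤m N≤n)

    abs-cauchy : ∀ {x} → Cauchy x → Cauchy (λ n → ℚ.∣ x n ∣)
    abs-cauchy {x} cx ε ε>0 with cx ε ε>0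
    ... | N , close = N , λ {m} {n} N≤m N≤n →
      ℚ.≤-trans (∣∣a∣-∣b∣∣≤∣a-b∣ (x m) (x n)) (close N≤m N≤n)

    *-cauchy : ∀ {x y} → Cauchy x → Cauchy y → Cauchy (λ n → x n ℚ.* y n)
    *-cauchy {x} {y} cx cy ε ε>0 =
      let a , a>0 , M₁ , x≤a     = bounded {x} cx
          b , b>0 , M₂ , y≤b     = bounded {y} cy
          δ , δ>0 , aδ+bδ≡ε      = split-ε {a} {b} {ε} a>0 b>0 ε>0
          N₁ , close₁            = cx δ δ>0
          N₂ , close₂            = cy δ δ>0
          M                      = M₁ ⊔ M₂
          N                      = N₁ ⊔ N₂
      in M ⊔ N , λ {m} {n} ≤m ≤n →
        ℚ.≤-trans
          (*-bound {a} {b} {x m} {x n} {y m} {y n} {δ} a>0 b>0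
            (x≤a (ℕ.m⊔n≤o⇒m≤o M₁ M₂ (ℕ.m⊔n≤o⇒m≤o M N ≤m)))
            (y≤b (ℕ.m⊔n≤o⇒n≤o M₁ M₂ (ℕ.m⊔n≤o⇒m≤o M N ≤n)))
            (close₁ (ℕ.m⊔n≤o⇒m≤o N₁ N₂ (ℕ.m⊔n≤o⇒n≤o M N ≤m)) (ℕ.m⊔n≤o⇒m≤o N₁ N₂ (ℕ.m⊔n≤o⇒n≤o M N ≤n)))
            (close₂ (ℕ.m⊔n≤o⇒n≤o N₁ N₂ (ℕ.m⊔n≤o⇒n≤o M N ≤m)) (ℕ.m⊔n≤o⇒n≤o N₁ N₂ (ℕ.m⊔n≤o⇒n≤o M N ≤n))))
          (ℚ.≤-reflexive aδ+bδ≡ε)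

open CauchyLemmas using (constant-cauchy; +-cauchy; neg-cauchy; abs-cauchy; *-cauchy)

infixl 7 _*ℝ_
infixl 6 _+ℝ_ _-ℝ_
infix  8 -ℝ_

fromℚ : ℚ → ℝ
fromℚ q = mkℝ (λ _ → q) (constant-cauchy q)

fromℕ : ℕ → ℝ
fromℕ n = fromℚ (ℤ.+ n ℚ./ 1)

0ℝ 1ℝ : ℝ
0ℝ = fromℚ 0ℚ
1ℝ = fromℚ 1ℚ

_+ℝ_ _*ℝ_ : ℝ → ℝ → ℝ
x +ℝ y = mkℝ (λ n → seq x n ℚ.+ seq y n) (+-cauchy {seq x} {seq y} (cauchy x) (cauchy y))
x *ℝ y = mkℝ (λ n → seq x n ℚ.* seq y n) (*-cauchy {seq x} {seq y} (cauchy x) (cauchy y))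

-ℝ_ : ℝ → ℝ
-ℝ x = mkℝ (λ n → ℚ.- seq x n) (neg-cauchy {seq x} (cauchy x))

_-ℝ_ : ℝ → ℝ → ℝ
x -ℝ y = x +ℝ (-ℝ y)

∣_∣ℝ : ℝ → ℝ
∣ x ∣ℝ = mkℝ (λ n → ℚ.∣ seq x n ∣) (abs-cauchy {seq x} (cauchy x))

ℝ-rawRing : RawRing 0ℓ 0ℓ
ℝ-rawRing = record
  { Carrier = ℝ ; _≈_ = _≈ℝ_ ; _+_ = _+ℝ_ ; _*_ = _*ℝ_ ; -_ = -ℝ_ ; 0# = 0ℝ ; 1# = 1ℝ }

open RawMonoidDefs (RawRing.+-rawMonoid ℝ-rawRing) public using (sum)

d : ∀ {n} → Vector ℝ n → Vector ℝ n → ℝ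
d x y = sum (λ i → ∣ x i -ℝ y i ∣ℝ)

-- A i is the i-th row of A.
Matrix : Set → ℕ → Set
Matrix A n = Fin n → Vector A n

identity : ∀ {n} → Matrix ℝ n
identity i j = if does (i Fin.≟ j) then 1ℝ else 0ℝ

infixl 7 _*ᴹ_
_*ᴹ_ : ∀ {n} → Matrix ℝ n → Matrix ℝ n → Matrix ℝ n
(A *ᴹ B) i j = sum (λ l → A i l *ℝ B l j)

-- ℝ[x]; the list c₀ ∷ c₁ ∷ … ∷ cₘ ∷ [] stands for c₀ + c₁x + … + cₘxᵐ.
Polynomial : Set
Polynomial = List ℝ

-- Evaluation at a matrix, by Horner's scheme.
infix 9 _⟨_⟩
_⟨_⟩ : ∀ {n} → Polynomial → Matrix ℝ n → Matrix ℝ n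
([]      ⟨ A ⟩) i j = 0ℝ
((c ∷ p) ⟨ A ⟩) i j = c *ℝ identity i j +ℝ (A *ᴹ (p ⟨ A ⟩)) i j

⁅_⁆? : ∀ {n} {P : Pred (Fin n) 0ℓ} → Decidable P → Subset n
⁅ P? ⁆? = tabulate (does ∘ P?)

infixl 5 _△_
_△_ : ∀ {n} → Subset n → Subset n → Subset n
p △ q = (p ─ q) ∪ (q ─ p)

indicator : ∀ {n} → Subset n → Vector ℝ n
indicator p i = if lookup p i then 1ℝ else 0ℝ

record SimpleGraph (n : ℕ) : Set₁ where
  infix 4 _~_ _~?_
  field
    _~_    : Rel (Fin n) 0ℓ
    _~?_   : B.Decidable _~_
    sym~   : Symmetric _~_
    irrefl : Irreflexive _≡_ _~_

private
  anyVec? : ∀ {n} l {P : Pred (Vec (Fin n) l) 0ℓ} → Decidable P → Dec (∃ P)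
  anyVec? zero    P? = map′ ([] ,_) (λ { ([] , p) → p }) (P? [])
  anyVec? (suc l) P? = map′ (λ { (x , xs , p) → x ∷ xs , p }) (λ { (x ∷ xs , p) → x , xs , p })
    (Fin.any? λ x → anyVec? l λ xs → P? (x ∷ xs))

Least : Pred ℕ 0ℓ → Pred ℕ 0ℓ
Least P m = P m × (∀ {l} → P l → m ℕ.≤ l)

private
  least : ∀ {P : Pred ℕ 0ℓ} → Decidable P → ∀ m → P m → ∃ (Least P)
  least P? m       pm with P? 0
  ...                 | yes p₀ = 0 , p₀ , λ _ → z≤n
  least P? zero    pm | no ¬p₀ = contradiction pm ¬p₀
  least P? (suc m) pm | no ¬p₀ with least (P? ∘ suc) m pm
  ... | l , pl , min = suc l , pl , λ { {zero} p₀ → contradiction p₀ ¬p₀ ; {suc _} p → s≤s (min p) }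

module _ {n : ℕ} (G : SimpleGraph n) where
  open SimpleGraph G

  neighbours : Fin n → Subset n
  neighbours u = ⁅ (u ~?_) ⁆?

  adjacencyMatrix : Matrix ℝ n
  adjacencyMatrix u = indicator (neighbours u)

  Path : Fin n → Fin n → Pred ℕ 0ℓ
  Path u v l = ∃ λ (p : Vec (Fin n) (suc l)) →
    head p ≡ u × last p ≡ v × Linked _~_ p × Unique p

  path? : ∀ u v → Decidable (Path u v)
  path? u v l = anyVec? (suc l) λ p →
    head p Fin.≟ u ×-dec last p Fin.≟ v ×-dec linked? _~?_ p ×-dec
    allPairs? (λ x y → ¬? (x Fin.≟ y)) p

  Connected : Set
  Connected = ∀ u v → ∃ (Path u v)

  module Metric (connected : Connected) where

    shortest : ∀ u v → ∃ (Least (Path u v))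
    shortest u v = least (path? u v) (proj₁ (connected u v)) (proj₂ (connected u v))

    ρ : Fin n → Fin n → ℕ
    ρ u v = proj₁ (shortest u v)

    diam : ℕ
    diam = max 0 (cartesianProductWith ρ (allFin n) (allFin n))

    ball : ℕ → Fin n → Subset n
    ball r u = ⁅ (λ v → ρ u v ≤? r) ⁆?

    sphere : ℕ → Fin n → Subset n
    sphere r u = ⁅ (λ v → ρ u v ≟ r) ⁆?

    ExpressesBalls : ℕ → Polynomial → Set
    ExpressesBalls r p = ∀ u v → (p ⟨ adjacencyMatrix ⟩) u v ≈ℝ indicator (ball r u) v

    ExpressesSpheres : ℕ → Polynomial → Set
    ExpressesSpheres r p = ∀ u v → (p ⟨ adjacencyMatrix ⟩) u v ≈ℝ indicator (sphere r u) v

  record DistanceRegular : Set where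
    field
      connected : Connected

    open Metric connected public

    field
      intersection-numbers : ∀ {u v u′ v′} → ρ u v ≡ ρ u′ v′ → ∀ i j →
        ∣ sphere i u ∩ sphere j v ∣ ≡ ∣ sphere i u′ ∩ sphere j v′ ∣

  PerfectColoring : ∀ {k} → (Fin n → Fin k) → Matrix ℕ k → Set
  PerfectColoring f S = ∀ i j u → f u ≡ i →
    ∣ neighbours u ∩ ⁅ (λ v → f v Fin.≟ j) ⁆? ∣ ≡ S i j

toℝ : ∀ {k} → Matrix ℕ k → Matrix ℝ k
toℝ S i j = fromℕ (S i j)

{-# OPTIONS --safe #-}
module Submission where

-- Let F be the 0/1 matrix with F u j = 1 iff f u = j.  A coloring is perfect iff M F = F S, whence
-- p(M) F = F p(S): the row of p(S) at f u is obtained from the row of p(M) at u by adding up the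
-- entries of each color.  Merging entries does not increase the L₁ distance of two rows, and the L₁
-- distance of two indicator functions is the size of the symmetric difference.
-- Ring operations on ℝ act index by index on Cauchy sequences, so all of this but the replacement
-- of p(M) by indicator functions happens exactly, in ℚ, at each index.

open import Defs
open import Algebra.Bundles using (CommutativeRing)
open import Data.Bool using (Bool; true; false; if_then_else_; _∧_)
open import Data.Bool.Properties using (if-float)
open import Data.Fin using (Fin)
import Data.Fin as Fin
open import Data.Fin.Subset using (Subset; inside; outside; _∩_; ∣_∣)
import Data.Integer as ℤ
import Data.Integer.Properties as ℤ
open import Data.List using ([]; _∷_)
open import Data.Nat using (ℕ; zero; suc; _≤_; _⊔_)
import Data.Nat.Properties as ℕ
open import Data.Product using (_×_; _,_)
open import Data.Rational as ℚ using (ℚ; 0ℚ; 1ℚ; ½)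
import Data.Rational.Properties as ℚ
open import Data.Rational.Solver using (module +-*-Solver)
import Data.Rational.Unnormalised as ℚᵘ
import Data.Rational.Unnormalised.Properties as ℚᵘ
open import Data.Vec using ([]; _∷_; lookup)
open import Data.Vec.Properties using (lookup-zipWith; lookup∘tabulate)
open import Data.Vec.Functional using (Vector)
open import Relation.Binary.PropositionalEquality
open import Relation.Nullary using (does)

open import Algebra.Properties.Semiring.Sum (CommutativeRing.semiring ℚ.+-*-commutativeRing)
  using (sum-cong-≗; sum-replicate-zero; ∑-distrib-+; ∑-comm; *-distribˡ-sum)
  renaming (sum to sumℚ)
open CauchyLemmas using (half-pos; ∣-∣-swap)

-- Finite sums in `ℚ`.

boolℚ : Bool → ℚ
boolℚ b = if b then 1ℚ else 0ℚ

δ : ∀ {n} → Fin n → Fin n → ℚ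
δ i j = boolℚ (does (i Fin.≟ j))

seq-bool : ∀ b m → seq (if b then 1ℝ else 0ℝ) m ≡ boolℚ b
seq-bool b m = if-float (λ x → seq x m) b

-- Transfers sums from `ℝ` to `ℚ`, where the semiring laws hold up to `≡` and the general lemmas on
-- finite sums apply.
seq-sum : ∀ {n} (x : Vector ℝ n) m → seq (sum x) m ≡ sumℚ (λ i → seq (x i) m)
seq-sum {zero}  x m = refl
seq-sum {suc n} x m = cong (seq (x Fin.zero) m ℚ.+_) (seq-sum (λ i → x (Fin.suc i)) m)

sumℚ-0* : ∀ {n} (x : Vector ℚ n) → sumℚ (λ i → 0ℚ ℚ.* x i) ≡ 0ℚ
sumℚ-0* {n} x = trans (sum-cong-≗ (λ i → ℚ.*-zeroˡ (x i))) (sum-replicate-zero n)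

sumℚ-δ : ∀ {n} (a : Fin n) (x : Vector ℚ n) → sumℚ (λ i → δ a i ℚ.* x i) ≡ x a
sumℚ-δ Fin.zero x = trans
  (cong₂ ℚ._+_ (ℚ.*-identityˡ (x Fin.zero)) (sumℚ-0* (λ i → x (Fin.suc i))))
  (ℚ.+-identityʳ (x Fin.zero))
sumℚ-δ (Fin.suc a) x = trans
  -- `does (Fin.suc a Fin.≟ Fin.suc i)` reduces to `does (a Fin.≟ i)`, so the tail is the same kind
  -- of sum for `a`.
  (cong₂ ℚ._+_ (ℚ.*-zeroˡ (x Fin.zero)) (sumℚ-δ a (λ i → x (Fin.suc i))))
  (ℚ.+-identityˡ (x (Fin.suc a)))

sumℚ-mono : ∀ {n} {x y : Vector ℚ n} → (∀ i → x i ℚ.≤ y i) → sumℚ x ℚ.≤ sumℚ y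
sumℚ-mono {zero}  x≤y = ℚ.≤-refl
sumℚ-mono {suc n} x≤y = ℚ.+-mono-≤ (x≤y Fin.zero) (sumℚ-mono (λ i → x≤y (Fin.suc i)))

∣sum-sum∣≤sum∣-∣ : ∀ {n} (x y : Vector ℚ n) →
  ℚ.∣ sumℚ x ℚ.- sumℚ y ∣ ℚ.≤ sumℚ (λ i → ℚ.∣ x i ℚ.- y i ∣)
∣sum-sum∣≤sum∣-∣ {zero}  x y = ℚ.≤-refl
∣sum-sum∣≤sum∣-∣ {suc n} x y = begin
  ℚ.∣ (x₀ ℚ.+ X) ℚ.- (y₀ ℚ.+ Y) ∣         ≡⟨ cong ℚ.∣_∣ (rearrange x₀ X y₀ Y) ⟩
  ℚ.∣ (x₀ ℚ.- y₀) ℚ.+ (X ℚ.- Y) ∣         ≤⟨ ℚ.∣p+q∣≤∣p∣+∣q∣ (x₀ ℚ.- y₀) (X ℚ.- Y) ⟩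
  ℚ.∣ x₀ ℚ.- y₀ ∣ ℚ.+ ℚ.∣ X ℚ.- Y ∣       ≤⟨ ℚ.+-monoʳ-≤ ℚ.∣ x₀ ℚ.- y₀ ∣ (∣sum-sum∣≤sum∣-∣ (λ i → x (Fin.suc i)) (λ i → y (Fin.suc i))) ⟩
  sumℚ (λ i → ℚ.∣ x i ℚ.- y i ∣)          ∎
  where
  open ℚ.≤-Reasoning
  x₀ = x Fin.zero
  y₀ = y Fin.zero
  X = sumℚ (λ i → x (Fin.suc i))
  Y = sumℚ (λ i → y (Fin.suc i))
  rearrange : ∀ a b c d → (a ℚ.+ b) ℚ.- (c ℚ.+ d) ≡ (a ℚ.- c) ℚ.+ (b ℚ.- d)
  rearrange = solve 4 (λ a b c d → (a :+ b) :- (c :+ d) := (a :- c) :+ (b :- d)) refl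
    where open +-*-Solver

-- Cardinalities and indicator functions.

-- `ℚ._/_` cancels a gcd, which does not compute for a variable `n`. In `ℚᵘ` equality is
-- cross-multiplication, so an identity of integers is enough.
suc/1 : ∀ n → ℤ.+ suc n ℚ./ 1 ≡ 1ℚ ℚ.+ ℤ.+ n ℚ./ 1
suc/1 n = ℚ.toℚᵘ-injective (begin-equality
  ℚ.toℚᵘ (ℤ.+ suc n ℚ./ 1)                  ≃⟨ ℚ.toℚᵘ-fromℚᵘ (ℚᵘ.mkℚᵘ (ℤ.+ suc n) 0) ⟩
  ℚᵘ.mkℚᵘ (ℤ.+ suc n) 0                     ≃⟨ ℚᵘ.*≡* (cong (ℤ._* ℤ.1ℤ) (cong (ℤ._+_ ℤ.1ℤ) (sym (ℤ.*-identityʳ (ℤ.+ n))))) ⟩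
  ℚᵘ.1ℚᵘ ℚᵘ.+ ℚᵘ.mkℚᵘ (ℤ.+ n) 0             ≃⟨ ℚᵘ.+-congʳ ℚᵘ.1ℚᵘ (ℚᵘ.≃-sym (ℚ.toℚᵘ-fromℚᵘ (ℚᵘ.mkℚᵘ (ℤ.+ n) 0))) ⟩
  ℚ.toℚᵘ 1ℚ ℚᵘ.+ ℚ.toℚᵘ (ℤ.+ n ℚ./ 1)       ≃⟨ ℚᵘ.≃-sym (ℚ.toℚᵘ-homo-+ 1ℚ (ℤ.+ n ℚ./ 1)) ⟩
  ℚ.toℚᵘ (1ℚ ℚ.+ ℤ.+ n ℚ./ 1)               ∎)
  where open ℚᵘ.≤-Reasoning

sumℚ-card : ∀ {n} (s : Subset n) → sumℚ (λ w → boolℚ (lookup s w)) ≡ ℤ.+ ∣ s ∣ ℚ./ 1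
sumℚ-card []            = refl
sumℚ-card (inside ∷ s)  = trans (cong (1ℚ ℚ.+_) (sumℚ-card s)) (sym (suc/1 ∣ s ∣))
sumℚ-card (outside ∷ s) = trans (ℚ.+-identityˡ _) (sumℚ-card s)

boolℚ-∧ : ∀ a b → boolℚ (a ∧ b) ≡ boolℚ a ℚ.* boolℚ b
boolℚ-∧ true  b = sym (ℚ.*-identityˡ (boolℚ b))
boolℚ-∧ false b = sym (ℚ.*-zeroˡ (boolℚ b))

∣boolℚ∣ : ∀ b → ℚ.∣ boolℚ b ∣ ≡ boolℚ b
∣boolℚ∣ true  = refl
∣boolℚ∣ false = refl

-- On 0/1 values the absolute difference is exclusive or, which is membership in `△`; the four cases
-- at `Fin.zero` are its truth table.
∣lookup-lookup∣ : ∀ {n} (s t : Subset n) w →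
  ℚ.∣ boolℚ (lookup s w) ℚ.- boolℚ (lookup t w) ∣ ≡ boolℚ (lookup (s △ t) w)
∣lookup-lookup∣ (true  ∷ s) (true  ∷ t) Fin.zero    = refl
∣lookup-lookup∣ (true  ∷ s) (false ∷ t) Fin.zero    = refl
∣lookup-lookup∣ (false ∷ s) (true  ∷ t) Fin.zero    = refl
∣lookup-lookup∣ (false ∷ s) (false ∷ t) Fin.zero    = refl
∣lookup-lookup∣ (_     ∷ s) (_     ∷ t) (Fin.suc w) = ∣lookup-lookup∣ s t w

d-indicator : ∀ {n} (s t : Subset n) m →
  seq (d (indicator s) (indicator t)) m ≡ seq (fromℕ ∣ s △ t ∣) m
d-indicator s t m = begin
  seq (d (indicator s) (indicator t)) m
    ≡⟨ seq-sum (λ w → ∣ indicator s w -ℝ indicator t w ∣ℝ) m ⟩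
  sumℚ (λ w → ℚ.∣ seq (indicator s w) m ℚ.- seq (indicator t w) m ∣)
    ≡⟨ sum-cong-≗ (λ w → cong₂ (λ a b → ℚ.∣ a ℚ.- b ∣) (seq-bool (lookup s w) m) (seq-bool (lookup t w) m)) ⟩
  sumℚ (λ w → ℚ.∣ boolℚ (lookup s w) ℚ.- boolℚ (lookup t w) ∣)
    ≡⟨ sum-cong-≗ (∣lookup-lookup∣ s t) ⟩
  sumℚ (λ w → boolℚ (lookup (s △ t) w))
    ≡⟨ sumℚ-card (s △ t) ⟩
  seq (fromℕ ∣ s △ t ∣) m ∎
  where open ≡-Reasoning

-- Estimates between Cauchy sequences.

-- Half of `ε` goes to the head and half to the whole tail, which halves its share again; this
-- avoids dividing `ε` by `n`.
sum-mono-≤ℝ : ∀ {n} (x y : Vector ℝ n) → (∀ i → x i ≤ℝ y i) → sum x ≤ℝ sum y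
sum-mono-≤ℝ {zero}  x y x≤y ε ε>0 = 0 , λ _ → ℚ.≤-trans (ℚ.<⇒≤ ε>0) (ℚ.≤-reflexive (sym (ℚ.+-identityˡ ε)))
sum-mono-≤ℝ {suc n} x y x≤y ε ε>0
  with x≤y Fin.zero (½ ℚ.* ε) (half-pos ε>0)
     | sum-mono-≤ℝ (λ i → x (Fin.suc i)) (λ i → y (Fin.suc i)) (λ i → x≤y (Fin.suc i)) (½ ℚ.* ε) (half-pos ε>0)
... | N₁ , head≤ | N₂ , tail≤ = N₁ ⊔ N₂ , λ {m} N≤m → ℚ.≤-trans
  (ℚ.+-mono-≤ (head≤ (ℕ.m⊔n≤o⇒m≤o N₁ N₂ N≤m)) (tail≤ (ℕ.m⊔n≤o⇒n≤o N₁ N₂ N≤m)))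
  (ℚ.≤-reflexive (regroup (seq (y Fin.zero) m) (seq (sum (λ i → y (Fin.suc i))) m) ε))
  where
  regroup : ∀ a b ε → (a ℚ.+ ½ ℚ.* ε) ℚ.+ (b ℚ.+ ½ ℚ.* ε) ≡ (a ℚ.+ b) ℚ.+ ε
  regroup = solve 3 (λ a b ε → (a :+ con ½ :* ε) :+ (b :+ con ½ :* ε) := (a :+ b) :+ ε) refl
    where open +-*-Solver

-- Triangle inequality along `x`, `x′`, `y′`, `y`: each of the two outer legs is at most half of `ε`
-- from some index on.
∣-∣-resp-≈ℝ : ∀ x x′ y y′ → x ≈ℝ x′ → y ≈ℝ y′ → ∣ x -ℝ y ∣ℝ ≤ℝ ∣ x′ -ℝ y′ ∣ℝ
∣-∣-resp-≈ℝ x x′ y y′ x≈x′ y≈y′ ε ε>0 with x≈x′ (½ ℚ.* ε) (half-pos ε>0) | y≈y′ (½ ℚ.* ε) (half-pos ε>0)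
... | N₁ , close₁ | N₂ , close₂ = N₁ ⊔ N₂ , λ {m} N≤m →
  bound (seq x m) (seq x′ m) (seq y m) (seq y′ m)
    (close₁ (ℕ.m⊔n≤o⇒m≤o N₁ N₂ N≤m)) (close₂ (ℕ.m⊔n≤o⇒n≤o N₁ N₂ N≤m))
  where
  open ℚ.≤-Reasoning
  split : ∀ a a′ b b′ → a ℚ.- b ≡ (a′ ℚ.- b′) ℚ.+ ((a ℚ.- a′) ℚ.+ (b′ ℚ.- b))
  split = solve 4 (λ a a′ b b′ → a :- b := (a′ :- b′) :+ ((a :- a′) :+ (b′ :- b))) refl
    where open +-*-Solver
  halves : ½ ℚ.* ε ℚ.+ ½ ℚ.* ε ≡ ε
  halves = trans (sym (ℚ.*-distribʳ-+ ε ½ ½)) (ℚ.*-identityˡ ε)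
  bound : ∀ a a′ b b′ → ℚ.∣ a ℚ.- a′ ∣ ℚ.≤ ½ ℚ.* ε → ℚ.∣ b ℚ.- b′ ∣ ℚ.≤ ½ ℚ.* ε →
    ℚ.∣ a ℚ.- b ∣ ℚ.≤ ℚ.∣ a′ ℚ.- b′ ∣ ℚ.+ ε
  bound a a′ b b′ a-a′≤ b-b′≤ = begin
    ℚ.∣ a ℚ.- b ∣
      ≡⟨ cong ℚ.∣_∣ (split a a′ b b′) ⟩
    ℚ.∣ (a′ ℚ.- b′) ℚ.+ ((a ℚ.- a′) ℚ.+ (b′ ℚ.- b)) ∣
      ≤⟨ ℚ.∣p+q∣≤∣p∣+∣q∣ (a′ ℚ.- b′) ((a ℚ.- a′) ℚ.+ (b′ ℚ.- b)) ⟩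
    ℚ.∣ a′ ℚ.- b′ ∣ ℚ.+ ℚ.∣ (a ℚ.- a′) ℚ.+ (b′ ℚ.- b) ∣
      ≤⟨ ℚ.+-monoʳ-≤ ℚ.∣ a′ ℚ.- b′ ∣ (ℚ.∣p+q∣≤∣p∣+∣q∣ (a ℚ.- a′) (b′ ℚ.- b)) ⟩
    ℚ.∣ a′ ℚ.- b′ ∣ ℚ.+ (ℚ.∣ a ℚ.- a′ ∣ ℚ.+ ℚ.∣ b′ ℚ.- b ∣)
      ≤⟨ ℚ.+-monoʳ-≤ ℚ.∣ a′ ℚ.- b′ ∣ (ℚ.+-mono-≤ a-a′≤ (ℚ.≤-trans (ℚ.≤-reflexive (∣-∣-swap b b′)) b-b′≤)) ⟩
    ℚ.∣ a′ ℚ.- b′ ∣ ℚ.+ (½ ℚ.* ε ℚ.+ ½ ℚ.* ε)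
      ≡⟨ cong (ℚ.∣ a′ ℚ.- b′ ∣ ℚ.+_) halves ⟩
    ℚ.∣ a′ ℚ.- b′ ∣ ℚ.+ ε ∎

-- Matrices intertwined by a coloring.

-- This is the associativity (x F) y = x (F y): after exchanging the sums, only the color `i = f w`
-- contributes for each `w`, and F y has the entry `y (f w)` at `w`.
sumℚ-colorwise : ∀ {n k} (f : Fin n → Fin k) (x : Vector ℚ n) (y : Vector ℚ k) →
  sumℚ (λ i → sumℚ (λ w → δ (f w) i ℚ.* x w) ℚ.* y i) ≡ sumℚ (λ w → x w ℚ.* y (f w))
sumℚ-colorwise {n} {k} f x y = begin
  sumℚ (λ i → sumℚ (λ w → δ (f w) i ℚ.* x w) ℚ.* y i)
    ≡⟨ sum-cong-≗ (λ i → trans (ℚ.*-comm _ (y i)) (*-distribˡ-sum (y i) (λ w → δ (f w) i ℚ.* x w))) ⟩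
  sumℚ (λ i → sumℚ (λ w → y i ℚ.* (δ (f w) i ℚ.* x w)))
    ≡⟨ ∑-comm (λ i w → y i ℚ.* (δ (f w) i ℚ.* x w)) ⟩
  sumℚ (λ w → sumℚ (λ i → y i ℚ.* (δ (f w) i ℚ.* x w)))
    ≡⟨ sum-cong-≗ (λ w → sum-cong-≗ (λ i → regroup (y i) (δ (f w) i) (x w))) ⟩
  sumℚ (λ w → sumℚ (λ i → δ (f w) i ℚ.* (x w ℚ.* y i)))
    ≡⟨ sum-cong-≗ (λ w → sumℚ-δ (f w) (λ i → x w ℚ.* y i)) ⟩
  sumℚ (λ w → x w ℚ.* y (f w)) ∎
  where
  open ≡-Reasoning
  regroup : ∀ a b c → a ℚ.* (b ℚ.* c) ≡ b ℚ.* (c ℚ.* a)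
  regroup = solve 3 (λ a b c → a :* (b :* c) := b :* (c :* a)) refl
    where open +-*-Solver

-- A F = F B at every index of the Cauchy sequences, where F u j = δ (f u) j.
Intertwines : ∀ {n k} → (Fin n → Fin k) → Matrix ℝ n → Matrix ℝ k → Set
Intertwines f A B = ∀ m u j → sumℚ (λ w → δ (f w) j ℚ.* seq (A u w) m) ≡ seq (B (f u) j) m

identity-intertwines : ∀ {n k} (f : Fin n → Fin k) → Intertwines f identity identity
identity-intertwines f m u j = begin
  sumℚ (λ w → δ (f w) j ℚ.* seq (identity u w) m)
    ≡⟨ sum-cong-≗ (λ w → trans (cong (δ (f w) j ℚ.*_) (seq-bool _ m)) (ℚ.*-comm (δ (f w) j) (δ u w))) ⟩
  sumℚ (λ w → δ u w ℚ.* δ (f w) j)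
    ≡⟨ sumℚ-δ u (λ w → δ (f w) j) ⟩
  δ (f u) j
    ≡⟨ seq-bool _ m ⟨
  seq (identity (f u) j) m ∎
  where open ≡-Reasoning

-- A A′ F = A F B′ = F B B′, written out entry by entry.
*ᴹ-intertwines : ∀ {n k} (f : Fin n → Fin k) (A A′ : Matrix ℝ n) (B B′ : Matrix ℝ k) →
  Intertwines f A B → Intertwines f A′ B′ → Intertwines f (A *ᴹ A′) (B *ᴹ B′)
*ᴹ-intertwines f A A′ B B′ AB A′B′ m u j = begin
  sumℚ (λ w → δ (f w) j ℚ.* seq ((A *ᴹ A′) u w) m)
    ≡⟨ sum-cong-≗ (λ w → trans (cong (δ (f w) j ℚ.*_) (seq-sum (λ l → A u l *ℝ A′ l w) m))
         (*-distribˡ-sum (δ (f w) j) (λ l → seq (A u l) m ℚ.* seq (A′ l w) m))) ⟩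
  sumℚ (λ w → sumℚ (λ l → δ (f w) j ℚ.* (seq (A u l) m ℚ.* seq (A′ l w) m)))
    ≡⟨ ∑-comm (λ w l → δ (f w) j ℚ.* (seq (A u l) m ℚ.* seq (A′ l w) m)) ⟩
  sumℚ (λ l → sumℚ (λ w → δ (f w) j ℚ.* (seq (A u l) m ℚ.* seq (A′ l w) m)))
    ≡⟨ sum-cong-≗ (λ l → trans
         (sum-cong-≗ (λ w → swap (δ (f w) j) (seq (A u l) m) (seq (A′ l w) m)))
         (sym (*-distribˡ-sum (seq (A u l) m) (λ w → δ (f w) j ℚ.* seq (A′ l w) m)))) ⟩
  sumℚ (λ l → seq (A u l) m ℚ.* sumℚ (λ w → δ (f w) j ℚ.* seq (A′ l w) m))
    ≡⟨ sum-cong-≗ (λ l → cong (seq (A u l) m ℚ.*_) (A′B′ m l j)) ⟩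
  sumℚ (λ l → seq (A u l) m ℚ.* seq (B′ (f l) j) m)
    -- The factor from `B′` depends on `l` only through its color `f l`, so the vertices can be
    -- grouped by color.
    ≡⟨ sumℚ-colorwise f (λ l → seq (A u l) m) (λ i → seq (B′ i j) m) ⟨
  sumℚ (λ i → sumℚ (λ l → δ (f l) i ℚ.* seq (A u l) m) ℚ.* seq (B′ i j) m)
    ≡⟨ sum-cong-≗ (λ i → cong (ℚ._* seq (B′ i j) m) (AB m u i)) ⟩
  sumℚ (λ i → seq (B (f u) i) m ℚ.* seq (B′ i j) m)
    ≡⟨ seq-sum (λ i → B (f u) i *ℝ B′ i j) m ⟨
  seq ((B *ᴹ B′) (f u) j) m ∎
  where
  open ≡-Reasoning
  swap : ∀ a b c → a ℚ.* (b ℚ.* c) ≡ b ℚ.* (a ℚ.* c)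
  swap = solve 3 (λ a b c → a :* (b :* c) := b :* (a :* c)) refl
    where open +-*-Solver

-- Induction along Horner's scheme: intertwining pairs contain the identities and are closed under
-- products, and the relation is linear in the pair.
⟨⟩-intertwines : ∀ {n k} (f : Fin n → Fin k) (A : Matrix ℝ n) (B : Matrix ℝ k) →
  Intertwines f A B → ∀ p → Intertwines f (p ⟨ A ⟩) (p ⟨ B ⟩)
⟨⟩-intertwines f A B AB [] m u j = trans
  (sum-cong-≗ (λ w → ℚ.*-comm (δ (f w) j) 0ℚ)) (sumℚ-0* (λ w → δ (f w) j))
⟨⟩-intertwines f A B AB (c ∷ p) m u j = begin
  sumℚ (λ w → δ (f w) j ℚ.* (γ ℚ.* I w ℚ.+ AP w))
    ≡⟨ sum-cong-≗ (λ w → expand (δ (f w) j) γ (I w) (AP w)) ⟩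
  sumℚ (λ w → γ ℚ.* (δ (f w) j ℚ.* I w) ℚ.+ δ (f w) j ℚ.* AP w)
    ≡⟨ ∑-distrib-+ (λ w → γ ℚ.* (δ (f w) j ℚ.* I w)) (λ w → δ (f w) j ℚ.* AP w) ⟩
  sumℚ (λ w → γ ℚ.* (δ (f w) j ℚ.* I w)) ℚ.+ sumℚ (λ w → δ (f w) j ℚ.* AP w)
    ≡⟨ cong (ℚ._+ sumℚ (λ w → δ (f w) j ℚ.* AP w)) (*-distribˡ-sum γ (λ w → δ (f w) j ℚ.* I w)) ⟨
  γ ℚ.* sumℚ (λ w → δ (f w) j ℚ.* I w) ℚ.+ sumℚ (λ w → δ (f w) j ℚ.* AP w)
    ≡⟨ cong₂ (λ a b → γ ℚ.* a ℚ.+ b) (identity-intertwines f m u j)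
         (*ᴹ-intertwines f A (p ⟨ A ⟩) B (p ⟨ B ⟩) AB (⟨⟩-intertwines f A B AB p) m u j) ⟩
  seq (((c ∷ p) ⟨ B ⟩) (f u) j) m ∎
  where
  open ≡-Reasoning
  γ = seq c m
  I = λ w → seq (identity u w) m
  AP = λ w → seq ((A *ᴹ (p ⟨ A ⟩)) u w) m
  expand : ∀ a b c d → a ℚ.* (b ℚ.* c ℚ.+ d) ≡ b ℚ.* (a ℚ.* c) ℚ.+ a ℚ.* d
  expand = solve 4 (λ a b c d → a :* (b :* c :+ d) := b :* (a :* c) :+ a :* d) refl
    where open +-*-Solver

-- An entry of M F sums the product of two indicator functions, which is the indicator function of
-- the intersection; it therefore counts the neighbours of `u` of color `j`.
perfectColoring⇒intertwines : ∀ {n k} (G : SimpleGraph n) (f : Fin n → Fin k) (S : Matrix ℕ k) →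
  PerfectColoring G f S → Intertwines f (adjacencyMatrix G) (toℝ S)
perfectColoring⇒intertwines G f S perfect m u j = begin
  sumℚ (λ w → δ (f w) j ℚ.* seq (adjacencyMatrix G u w) m)
    ≡⟨ sum-cong-≗ pointwise ⟩
  sumℚ (λ w → boolℚ (lookup (neighbours G u ∩ color) w))
    ≡⟨ sumℚ-card (neighbours G u ∩ color) ⟩
  ℤ.+ ∣ neighbours G u ∩ color ∣ ℚ./ 1
    ≡⟨ cong (λ s → ℤ.+ s ℚ./ 1) (perfect (f u) j u refl) ⟩
  seq (toℝ S (f u) j) m ∎
  where
  open ≡-Reasoning
  color = ⁅ (λ v → f v Fin.≟ j) ⁆?
  pointwise : ∀ w → δ (f w) j ℚ.* seq (adjacencyMatrix G u w) m
    ≡ boolℚ (lookup (neighbours G u ∩ color) w)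
  pointwise w = begin
    δ (f w) j ℚ.* seq (adjacencyMatrix G u w) m
      ≡⟨ cong₂ ℚ._*_ (cong boolℚ (sym (lookup∘tabulate (λ v → does (f v Fin.≟ j)) w)))
           (seq-bool (lookup (neighbours G u) w) m) ⟩
    boolℚ (lookup color w) ℚ.* boolℚ (lookup (neighbours G u) w)
      ≡⟨ ℚ.*-comm (boolℚ (lookup color w)) (boolℚ (lookup (neighbours G u) w)) ⟩
    boolℚ (lookup (neighbours G u) w) ℚ.* boolℚ (lookup color w)
      ≡⟨ boolℚ-∧ (lookup (neighbours G u) w) (lookup color w) ⟨
    boolℚ (lookup (neighbours G u) w ∧ lookup color w)
      ≡⟨ cong boolℚ (lookup-zipWith _∧_ w (neighbours G u) color) ⟨
    boolℚ (lookup (neighbours G u ∩ color) w) ∎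

-- Comparison of L₁ distances.

-- The triangle inequality is applied inside each color class. The classes partition the vertices,
-- so each term `ℚ.∣ x w ℚ.- y w ∣` is counted exactly once, for the color `f w`.
d-contracts : ∀ {n k} (f : Fin n → Fin k) (A : Matrix ℝ n) (B : Matrix ℝ k) → Intertwines f A B →
  ∀ u v m → seq (d (B (f u)) (B (f v))) m ℚ.≤ seq (d (A u) (A v)) m
d-contracts f A B AB u v m = begin
  seq (d (B (f u)) (B (f v))) m
    ≡⟨ seq-sum (λ j → ∣ B (f u) j -ℝ B (f v) j ∣ℝ) m ⟩
  sumℚ (λ j → ℚ.∣ seq (B (f u) j) m ℚ.- seq (B (f v) j) m ∣)
    ≡⟨ sum-cong-≗ (λ j → cong₂ (λ a b → ℚ.∣ a ℚ.- b ∣) (AB m u j) (AB m v j)) ⟨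
  sumℚ (λ j → ℚ.∣ sumℚ (λ w → δ (f w) j ℚ.* x w) ℚ.- sumℚ (λ w → δ (f w) j ℚ.* y w) ∣)
    ≤⟨ sumℚ-mono (λ j → ∣sum-sum∣≤sum∣-∣ (λ w → δ (f w) j ℚ.* x w) (λ w → δ (f w) j ℚ.* y w)) ⟩
  sumℚ (λ j → sumℚ (λ w → ℚ.∣ δ (f w) j ℚ.* x w ℚ.- δ (f w) j ℚ.* y w ∣))
    ≡⟨ sum-cong-≗ (λ j → sum-cong-≗ (λ w → factor (does (f w Fin.≟ j)) (x w) (y w))) ⟩
  sumℚ (λ j → sumℚ (λ w → δ (f w) j ℚ.* ℚ.∣ x w ℚ.- y w ∣))
    ≡⟨ ∑-comm (λ j w → δ (f w) j ℚ.* ℚ.∣ x w ℚ.- y w ∣) ⟩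
  sumℚ (λ w → sumℚ (λ j → δ (f w) j ℚ.* ℚ.∣ x w ℚ.- y w ∣))
    ≡⟨ sum-cong-≗ (λ w → sumℚ-δ (f w) (λ _ → ℚ.∣ x w ℚ.- y w ∣)) ⟩
  sumℚ (λ w → ℚ.∣ x w ℚ.- y w ∣)
    ≡⟨ seq-sum (λ w → ∣ A u w -ℝ A v w ∣ℝ) m ⟨
  seq (d (A u) (A v)) m ∎
  where
  open ℚ.≤-Reasoning
  x = λ w → seq (A u w) m
  y = λ w → seq (A v w) m
  factor : ∀ b p q → ℚ.∣ boolℚ b ℚ.* p ℚ.- boolℚ b ℚ.* q ∣ ≡ boolℚ b ℚ.* ℚ.∣ p ℚ.- q ∣
  factor b p q = trans
    (cong ℚ.∣_∣ (solve 3 (λ b p q → b :* p :- b :* q := b :* (p :- q)) refl (boolℚ b) p q))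
    (trans (ℚ.∣p*q∣≡∣p∣*∣q∣ (boolℚ b) (p ℚ.- q)) (cong (ℚ._* ℚ.∣ p ℚ.- q ∣) (∣boolℚ∣ b)))
    where open +-*-Solver

-- Stated for any family `s` of vertex sets whose indicator functions are the rows of p(M), so that
-- balls and spheres are both instances.
d≤∣△∣ : ∀ {n k} (G : SimpleGraph n) (f : Fin n → Fin k) (S : Matrix ℕ k) → PerfectColoring G f S →
  ∀ p (s : Fin n → Subset n) → (∀ u v → (p ⟨ adjacencyMatrix G ⟩) u v ≈ℝ indicator (s u) v) →
  ∀ u v → d ((p ⟨ toℝ S ⟩) (f u)) ((p ⟨ toℝ S ⟩) (f v)) ≤ℝ fromℕ ∣ s u △ s v ∣
d≤∣△∣ G f S perfect p s expresses u v ε ε>0 =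
  let N , close = rows≤ ε ε>0 in N , λ {m} N≤m → begin
    seq (d ((p ⟨ toℝ S ⟩) (f u)) ((p ⟨ toℝ S ⟩) (f v))) m
      ≤⟨ d-contracts f P (p ⟨ toℝ S ⟩)
           (⟨⟩-intertwines f (adjacencyMatrix G) (toℝ S) (perfectColoring⇒intertwines G f S perfect) p) u v m ⟩
    seq (d (P u) (P v)) m
      -- The only step that costs `ε` and needs a large index; the others hold at every `m`.
      ≤⟨ close N≤m ⟩
    seq (d (indicator (s u)) (indicator (s v))) m ℚ.+ ε
      ≡⟨ cong (ℚ._+ ε) (d-indicator (s u) (s v) m) ⟩
    seq (fromℕ ∣ s u △ s v ∣) m ℚ.+ ε ∎
  where
  open ℚ.≤-Reasoning
  P = p ⟨ adjacencyMatrix G ⟩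
  rows≤ : d (P u) (P v) ≤ℝ d (indicator (s u)) (indicator (s v))
  rows≤ = sum-mono-≤ℝ
    (λ w → ∣ P u w -ℝ P v w ∣ℝ) (λ w → ∣ indicator (s u) w -ℝ indicator (s v) w ∣ℝ)
    (λ w → ∣-∣-resp-≈ℝ (P u w) (indicator (s u) w) (P v w) (indicator (s v) w)
      (expresses u w) (expresses v w))

theorem5 : ∀ {n k : ℕ} (G : SimpleGraph n) (dr : DistanceRegular G) →
    let open DistanceRegular dr in
    (r : ℕ) → r ≤ diam →
    (pᴮ pᵂ : Polynomial) → ExpressesBalls r pᴮ → ExpressesSpheres r pᵂ →
    (f : Fin n → Fin k) (S : Matrix ℕ k) → PerfectColoring G f S →
    (u v : Fin n) →
    (d ((pᴮ ⟨ toℝ S ⟩) (f u)) ((pᴮ ⟨ toℝ S ⟩) (f v)) ≤ℝ fromℕ ∣ ball r u △ ball r v ∣)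
    × (d ((pᵂ ⟨ toℝ S ⟩) (f u)) ((pᵂ ⟨ toℝ S ⟩) (f v)) ≤ℝ fromℕ ∣ sphere r u △ sphere r v ∣)
theorem5 G dr r _ pᴮ pᵂ balls spheres f S perfect u v =
    d≤∣△∣ G f S perfect pᴮ (ball r) balls u v
  , d≤∣△∣ G f S perfect pᵂ (sphere r) spheres u v
  where open DistanceRegular dr
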